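{- Let $F$ be a recurrent set and let $X\subset F$ be a bifix code of finite $F$-degree $d$. Then the set of nonempty proper suffixes of words of $X$ is a disjoint union of $d-1$ $F$-maximal prefix codes.
   Context: $A$ is a finite alphabet. $F\subset A^*$ is recurrent if it is nonempty, closed under factors, and for all $u,w\in F$ there is $v\in F$ with $uvw\in F$. A prefix code is a set of nonempty words none of which is a proper prefix of another; a bifix code is also suffix (no element a proper suffix of another). A prefix code $Y\subset F$ is $F$-maximal if it is not properly contained in any prefix code contained in $F$. A parse of $w$ with respect to $X$ is a triple $(v,x,u)$ with $w=vxu$, $v$ having no suffix in $X$, $x\in X^*$, $u$ having no prefix in $X$; $\delta_X(w)$ is their number and $d_F(X)=\max_{w\in F}\delta_X(w)$. -}

module Defs where

open import Data.Fin.Base using (Fin)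
open import Data.List.Base using (List; []; _++_; concat; length)
open import Data.List.Membership.Propositional using () renaming (_∈_ to _∈ₗ_)
open import Data.List.Relation.Binary.Infix.Heterogeneous using (Infix)
open import Data.List.Relation.Binary.Prefix.Heterogeneous using (Prefix)
open import Data.List.Relation.Binary.Suffix.Heterogeneous using (Suffix)
open import Data.List.Relation.Unary.All using (All)
open import Data.List.Relation.Unary.Unique.Propositional using (Unique)
open import Data.Nat.Base using (ℕ; _≤_)
open import Data.Product.Base using (_×_; _,_; ∃-syntax)
open import Function.Bundles using (_⇔_)
open import Level using (0ℓ)
open import Relation.Binary.PropositionalEquality.Core using (_≡_; _≢_)
open import Relation.Nullary.Negation.Core using (¬_)
open import Relation.Unary using (Pred; _∈_; _⊆_; _⊥_; _≐_; ⋃; Satisfiable)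

-- P has exactly n elements. Elements are enumerated, not membership proofs,
-- so P need not be proof-irrelevant.
HasCardinality : {B : Set} → Pred B 0ℓ → ℕ → Set
HasCardinality {B} P n =
  ∃[ l ] Unique l × length l ≡ n × (∀ (b : B) → b ∈ₗ l ⇔ b ∈ P)

module _ {A : Set} where

  Language : Set₁
  Language = Pred (List A) 0ℓ

  IsPrefixOf IsSuffixOf IsFactorOf : List A → List A → Set
  IsPrefixOf = Prefix _≡_
  IsSuffixOf = Suffix _≡_
  IsFactorOf = Infix _≡_

  IsProperPrefixOf IsProperSuffixOf : List A → List A → Set
  IsProperPrefixOf u w = IsPrefixOf u w × u ≢ w
  IsProperSuffixOf u w = IsSuffixOf u w × u ≢ w

  record IsRecurrent (F : Language) : Set where
    field
      nonempty      : Satisfiable F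
      factor-closed : ∀ {u w} → IsFactorOf u w → w ∈ F → u ∈ F
      recurrent     : ∀ {u w} → u ∈ F → w ∈ F →
                      ∃[ v ] v ∈ F × (u ++ v ++ w) ∈ F

  record IsPrefixCode (X : Language) : Set where
    field
      nonempty-words   : ∀ {x} → x ∈ X → x ≢ []
      no-proper-prefix : ∀ {x y} → x ∈ X → y ∈ X → ¬ IsProperPrefixOf x y

  record IsBifixCode (X : Language) : Set where
    field
      isPrefixCode     : IsPrefixCode X
      no-proper-suffix : ∀ {x y} → x ∈ X → y ∈ X → ¬ IsProperSuffixOf x y

  record IsMaximalPrefixCode (F Y : Language) : Set₁ where
    field
      isPrefixCode : IsPrefixCode Y
      contained    : Y ⊆ F
      maximal      : (Z : Language) → IsPrefixCode Z → Z ⊆ F → Y ⊆ Z → Z ⊆ Y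

  -- The submonoid X* of A* generated by X.
  Star : Language → Language
  Star X w = ∃[ xs ] All X xs × w ≡ concat xs

  IsParse : Language → List A → Pred (List A × List A × List A) 0ℓ
  IsParse X w (v , x , u) =
    w ≡ v ++ x ++ u ×
    ¬ (∃[ s ] s ∈ X × IsSuffixOf s v) ×
    x ∈ Star X ×
    ¬ (∃[ p ] p ∈ X × IsPrefixOf p u)

  -- δ_X(w) = n, as a relation: X is an arbitrary predicate, so the number
  -- of parses is not computable as a function of w.
  ParseCount : Language → List A → ℕ → Set
  ParseCount X w = HasCardinality (IsParse X w)

  -- d_F(X) = d, i.e. d is the maximum of δ_X over F. The set of parses of w
  -- is always finite classically, so asking that every w ∈ F have a parse
  -- count only makes explicit that δ_X is defined on F.
  record HasDegree (F X : Language) (d : ℕ) : Set where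
    field
      bounded  : ∀ {w} → w ∈ F → ∃[ n ] ParseCount X w n × n ≤ d
      attained : ∃[ w ] w ∈ F × ParseCount X w d

  NonemptyProperSuffixes : Language → Language
  NonemptyProperSuffixes X s = s ≢ [] × ∃[ x ] x ∈ X × IsProperSuffixOf s x

  record IsDisjointUnionOfMaximalPrefixCodes
         (F S : Language) (n : ℕ) : Set₁ where
    field
      part      : Fin n → Language
      maximal   : ∀ i → IsMaximalPrefixCode F (part i)
      disjoint  : ∀ {i j} → i ≢ j → part i ⊥ part j
      union     : S ≐ ⋃ (Fin n) part

{-# OPTIONS --safe #-}
-- For a prefix code X, a parse (v , x , u) of w is determined by v, so δ_X(w)
-- counts the prefixes of w without suffix in X.  Hence δ grows by 0 or 1 when
-- a letter is appended on the right, and does not decrease when one is added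
-- on the left.  The parts are the nonempty proper suffixes s of words of X
-- with δ(s) = i, for i = 2, …, d.  Any z ∈ F extends on the right to a word of
-- F with δ = d; some prefix p of it has no suffix in X and δ(p) = i.  Extending
-- p on the left by a word with δ = d cannot increase δ, so the long word has a
-- suffix in X, and p is a proper suffix of that suffix.  Thus z is
-- prefix-comparable to an element of the i-th part.
--
-- Constructively, X is decidable on F: ([] , w , []) is a parse of w exactly
-- when w ∈ X*, and the parses of w are listed.
module Submission where

open import Defs
open import Data.Fin.Base using (Fin; toℕ; fromℕ<)
import Data.Fin.Properties as Fin
open import Data.List.Base using (List; []; _∷_; _++_; _∷ʳ_; concat; length)
open import Data.List.Properties using (++-assoc; ++-identityʳ; ++-identityʳ-unique; ++-cancelˡ; ++-conicalˡ; ++-conicalʳ; length-++; ≡-dec)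
open import Data.List.Membership.Propositional using () renaming (_∈_ to _∈ₗ_)
open import Data.List.Membership.Propositional.Properties using (∈-∃++; ∈-++⁻; ∈-++⁺ˡ; ∈-++⁺ʳ)
import Data.List.Membership.DecPropositional as DecMembership
open import Data.List.Relation.Binary.Infix.Heterogeneous using (here)
open import Data.List.Relation.Binary.Infix.Heterogeneous.Properties using (fromSuffix)
open import Data.List.Relation.Binary.Pointwise using (Pointwise-≡⇒≡; ≡⇒Pointwise-≡)
open import Data.List.Relation.Binary.Prefix.Heterogeneous using ([]; _∷_; _++ᵖ_)
import Data.List.Relation.Binary.Prefix.Heterogeneous.Properties as Prefix
open import Data.List.Relation.Binary.Suffix.Heterogeneous using (here; there; _++ˢ_)
import Data.List.Relation.Binary.Suffix.Heterogeneous.Properties as Suffix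
open import Data.List.Relation.Unary.All using (All; []; _∷_)
import Data.List.Relation.Unary.All as All
open import Data.List.Relation.Unary.AllPairs using ([]; _∷_)
open import Data.List.Relation.Unary.Any using (here; there)
open import Data.List.Relation.Unary.Unique.Propositional using (Unique)
open import Data.List.Reverse using (Reverse; []; _∶_∶ʳ_; reverseView)
open import Data.Nat.Base using (ℕ; suc; _+_; _∸_; _≤_; _<_; z≤n; s≤s)
open import Data.Nat.Induction using (<-wellFounded)
open import Data.Nat.Properties using (≤-trans; ≤-antisym; ≤-reflexive; n≮n; m≤n⇒m<n∨m≡n; +-suc; suc-injective; ∸-monoˡ-≤; m≤n+m; ≤-pred; <⇒≱)
open import Data.Product.Base using (_×_; _,_; proj₁; proj₂; ∃-syntax)
open import Data.Product.Properties using () renaming (≡-dec to ×-≡-dec)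
open import Data.Sum.Base using (_⊎_; inj₁; inj₂)
open import Function.Base using (_∘_)
open import Function.Bundles using (_↔_; mk⇔; Equivalence)
open import Function.Properties.Inverse using (↔⇒↣)
open import Induction.WellFounded using (Acc; acc)
open import Level using (0ℓ)
open import Relation.Binary.Definitions using (DecidableEquality)
open import Relation.Binary.PropositionalEquality
open import Relation.Nullary using (¬_; Dec; yes; no; contradiction)
open import Relation.Nullary.Decidable using (decidable-stable; via-injection; map′)
open import Relation.Unary using (Pred; _∈_; _⊆_; _≐_)

-- Cardinality

module _ {B C : Set} where

  -- The partner `c` of the head is cut out of `l′`; injectivity of `R` ensures that no later
  -- element is matched with that `c`. A relation suits matchings that are described by cases.
  pigeonhole : (R : B → C → Set) →
    (∀ {b b′ c} → R b c → R b′ c → b ≡ b′) →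
    ∀ {l l′} → Unique l → (∀ {b} → b ∈ₗ l → ∃[ c ] c ∈ₗ l′ × R b c) →
    length l ≤ length l′
  pigeonhole R inj {[]}    []       f = z≤n
  pigeonhole R inj {b ∷ l} (b∉ ∷ u) f with f (here refl)
  ... | c , c∈l′ , Rbc with ∈-∃++ c∈l′
  ...   | ys , zs , refl =
    ≤-trans (s≤s (pigeonhole R inj u g))
            (≤-reflexive (trans (cong suc (length-++ ys))
              (sym (trans (length-++ ys) (+-suc (length ys) (length zs))))))
    where
    g : ∀ {b′} → b′ ∈ₗ l → ∃[ c′ ] c′ ∈ₗ (ys ++ zs) × R b′ c′
    g b′∈l with f (there b′∈l)
    ... | c′ , c′∈ , Rb′c′ with ∈-++⁻ ys c′∈
    ...   | inj₁ c′∈ys         = c′ , ∈-++⁺ˡ c′∈ys , Rb′c′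
    ...   | inj₂ (here refl)   = contradiction (inj Rbc Rb′c′) (All.lookup b∉ b′∈l)
    ...   | inj₂ (there c′∈zs) = c′ , ∈-++⁺ʳ ys c′∈zs , Rb′c′

  cardinality-≤ : {P : Pred B 0ℓ} {Q : Pred C 0ℓ} (R : B → C → Set) →
    (∀ {b b′ c} → b ∈ P → b′ ∈ P → R b c → R b′ c → b ≡ b′) →
    (∀ {b} → b ∈ P → ∃[ c ] c ∈ Q × R b c) →
    ∀ {m n} → HasCardinality P m → HasCardinality Q n → m ≤ n
  cardinality-≤ {P} R inj f (l , u , refl , l⇔P) (l′ , _ , refl , l′⇔Q) =
    -- Injectivity is assumed on `P` only, so membership in `P` is packed into the relation.
    pigeonhole (λ b c → b ∈ P × R b c) (λ (p , r) (p′ , r′) → inj p p′ r r′) u λ {b} b∈l →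
      let b∈P = Equivalence.to (l⇔P b) b∈l ; c , c∈Q , r = f b∈P
      in c , Equivalence.from (l′⇔Q c) c∈Q , b∈P , r

length≤cardinality : ∀ {B : Set} {P : Pred B 0ℓ} {n l} → HasCardinality P n →
  Unique l → (∀ {b} → b ∈ₗ l → b ∈ P) → length l ≤ n
length≤cardinality (l′ , _ , refl , l′⇔P) u l⊆P =
  pigeonhole _≡_ (λ p q → trans p (sym q)) u
    λ {b} b∈l → b , Equivalence.from (l′⇔P b) (l⊆P b∈l) , refl

module _ {B : Set} {P Q : Pred B 0ℓ} where

  -- Prepending `b` to an enumeration of `P` gives a repetition-free list inside `Q`.
  cardinality-< : ∀ {m n} b → ¬ b ∈ P → b ∈ Q → P ⊆ Q →
    HasCardinality P m → HasCardinality Q n → m < n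
  cardinality-< b b∉P b∈Q P⊆Q (l , u , refl , l⇔P) cQ =
    length≤cardinality cQ
      (All.tabulate (λ { {c} c∈l refl → b∉P (Equivalence.to (l⇔P c) c∈l) }) ∷ u)
      λ { (here refl) → b∈Q ; {c} (there c∈l) → P⊆Q (Equivalence.to (l⇔P c) c∈l) }

  cardinality-insert : ∀ {n} b → ¬ b ∈ P → b ∈ Q → P ⊆ Q →
    (∀ {c} → c ∈ Q → c ∈ P ⊎ c ≡ b) →
    HasCardinality P n → HasCardinality Q (suc n)
  cardinality-insert b b∉P b∈Q P⊆Q Q⊆ (l , u , refl , l⇔P) =
    b ∷ l ,
    All.tabulate (λ { {c} c∈l refl → b∉P (Equivalence.to (l⇔P c) c∈l) }) ∷ u ,
    refl ,
    λ c → mk⇔ (λ { (here refl) → b∈Q ; (there c∈l) → P⊆Q (Equivalence.to (l⇔P c) c∈l) })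
              (from c ∘ Q⊆)
    where
    from : ∀ c → c ∈ P ⊎ c ≡ b → c ∈ₗ (b ∷ l)
    from c (inj₁ c∈P)  = there (Equivalence.from (l⇔P c) c∈P)
    from c (inj₂ refl) = here refl

  cardinality-cong : ∀ {n} → P ≐ Q → HasCardinality P n → HasCardinality Q n
  cardinality-cong (P⊆Q , Q⊆P) (l , u , len , l⇔P) =
    l , u , len , λ b → mk⇔ (P⊆Q ∘ Equivalence.to (l⇔P b)) (Equivalence.from (l⇔P b) ∘ Q⊆P)

cardinality-unique : ∀ {B : Set} {P : Pred B 0ℓ} {m n} →
  HasCardinality P m → HasCardinality P n → m ≡ n
cardinality-unique c c′ = ≤-antisym (le c c′) (le c′ c)
  where
  le : ∀ {m n} → HasCardinality _ m → HasCardinality _ n → m ≤ n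
  le = cardinality-≤ _≡_ (λ _ _ p q → trans p (sym q)) (λ {b} p → b , p , refl)

-- Prefixes and suffixes

module _ {A : Set} where

  prefix-refl : {w : List A} → IsPrefixOf w w
  prefix-refl = Prefix.fromPointwise (≡⇒Pointwise-≡ refl)

  prefix-trans : {u v w : List A} → IsPrefixOf u v → IsPrefixOf v w → IsPrefixOf u w
  prefix-trans = Prefix.trans trans

  prefix-antisym : {u v : List A} → IsPrefixOf u v → IsPrefixOf v u → u ≡ v
  prefix-antisym p q = Pointwise-≡⇒≡ (Prefix.antisym (λ e _ → e) p q)

  prefix-++ : (u t : List A) → IsPrefixOf u (u ++ t)
  prefix-++ u t = prefix-refl ++ᵖ t

  prefix⇒++ : {u w : List A} → IsPrefixOf u w → ∃[ t ] w ≡ u ++ t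
  prefix⇒++ []         = _ , refl
  prefix⇒++ (refl ∷ p) with prefix⇒++ p
  ... | t , refl = t , refl

  prefix-total : {u v w : List A} → IsPrefixOf u w → IsPrefixOf v w →
                 IsPrefixOf u v ⊎ IsPrefixOf v u
  prefix-total []         q          = inj₁ []
  prefix-total (refl ∷ p) []         = inj₂ []
  prefix-total (refl ∷ p) (refl ∷ q) with prefix-total p q
  ... | inj₁ r = inj₁ (refl ∷ r)
  ... | inj₂ r = inj₂ (refl ∷ r)

  prefix-∷ʳ⁻ : {v : List A} (w : List A) {a : A} → IsPrefixOf v (w ∷ʳ a) →
               IsPrefixOf v w ⊎ v ≡ w ∷ʳ a
  prefix-∷ʳ⁻ []      []          = inj₁ []
  prefix-∷ʳ⁻ []      (refl ∷ []) = inj₂ refl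
  prefix-∷ʳ⁻ (x ∷ w) []          = inj₁ []
  prefix-∷ʳ⁻ (x ∷ w) (refl ∷ p)  with prefix-∷ʳ⁻ w p
  ... | inj₁ q    = inj₁ (refl ∷ q)
  ... | inj₂ refl = inj₂ refl

  ∷ʳ-not-prefix : (w : List A) {a : A} → ¬ IsPrefixOf (w ∷ʳ a) w
  ∷ʳ-not-prefix (x ∷ w) (_ ∷ p) = ∷ʳ-not-prefix w p

  suffix-total : {u v w : List A} → IsSuffixOf u w → IsSuffixOf v w →
                 IsSuffixOf u v ⊎ IsSuffixOf v u
  suffix-total (here p)  q        rewrite Pointwise-≡⇒≡ p = inj₂ q
  suffix-total (there p) (here q) rewrite Pointwise-≡⇒≡ q = inj₁ (there p)
  suffix-total (there p) (there q) = suffix-total p q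

  length-<-++ : ∀ {x} (t : List A) → x ≢ [] → length t < length (x ++ t)
  length-<-++ {[]}    t x≢[] = contradiction refl x≢[]
  length-<-++ {a ∷ x} t _    =
    s≤s (≤-trans (m≤n+m (length t) (length x)) (≤-reflexive (sym (length-++ x))))

  HasPrefixIn HasSuffixIn : Language {A} → Language {A}
  HasPrefixIn X w = ∃[ p ] p ∈ X × IsPrefixOf p w
  HasSuffixIn X w = ∃[ s ] s ∈ X × IsSuffixOf s w

  -- These are the candidates for the first component of a parse of `w`. Their number stands in for
  -- `δ_X(w)`, which avoids handling factorisations when words are extended.
  SuffixFreePrefix : Language {A} → List A → Language {A}
  SuffixFreePrefix X w v = IsPrefixOf v w × ¬ HasSuffixIn X v

  suffixFreePrefix-mono : ∀ {X u w} → IsPrefixOf u w → SuffixFreePrefix X u ⊆ SuffixFreePrefix X w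
  suffixFreePrefix-mono u≤w (v≤u , v-free) = prefix-trans v≤u u≤w , v-free

-- Parses with respect to a prefix code

module PrefixCodeParses {A : Set} (_≟_ : DecidableEquality A)
  {X : Language {A}} (X-code : IsPrefixCode X) where

  open IsPrefixCode X-code

  _≟ʷ_ : DecidableEquality (List A)
  _≟ʷ_ = ≡-dec _≟_

  prefix⇒≡ : ∀ {x y} → x ∈ X → y ∈ X → IsPrefixOf x y → x ≡ y
  prefix⇒≡ {x} {y} x∈X y∈X x≤y =
    decidable-stable (x ≟ʷ y) λ x≢y → no-proper-prefix x∈X y∈X (x≤y , x≢y)

  common-extension⇒≡ : ∀ {x y w} → x ∈ X → y ∈ X → IsPrefixOf x w → IsPrefixOf y w → x ≡ y
  common-extension⇒≡ x∈X y∈X p q with prefix-total p q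
  ... | inj₁ r = prefix⇒≡ x∈X y∈X r
  ... | inj₂ r = sym (prefix⇒≡ y∈X x∈X r)

  []-no-prefix : ¬ HasPrefixIn X []
  []-no-prefix (_ , p∈X , []) = nonempty-words p∈X refl

  []-no-suffix : ¬ HasSuffixIn X []
  []-no-suffix (_ , s∈X , here p) = nonempty-words s∈X (Pointwise-≡⇒≡ p)

  []-suffixFree : ∀ w → SuffixFreePrefix X w []
  []-suffixFree w = [] , []-no-suffix

  cardinality-[] : HasCardinality (SuffixFreePrefix X []) 1
  cardinality-[] = [] ∷ [] , [] ∷ [] , refl , λ v → mk⇔
    (λ { (here refl) → []-suffixFree [] })
    (λ { ([] , _) → here refl })

  cardinality≥2⇒nonempty : ∀ {w n} → 2 ≤ n → HasCardinality (SuffixFreePrefix X w) n → w ≢ []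
  cardinality≥2⇒nonempty 2≤n c refl = <⇒≱ 2≤n (≤-reflexive (cardinality-unique c cardinality-[]))

  -- Decoding from the left is forced: two first factors are prefixes of one word, hence equal, and
  -- cancel. If one side runs out of factors first, its remainder begins with a codeword, against
  -- the assumption on remainders.
  factorisation-unique : ∀ {xs ys u u′} → All X xs → All X ys →
    ¬ HasPrefixIn X u → ¬ HasPrefixIn X u′ →
    concat xs ++ u ≡ concat ys ++ u′ → concat xs ≡ concat ys × u ≡ u′
  factorisation-unique [] [] _ _ eq = refl , eq
  factorisation-unique {ys = y ∷ ys} {u′ = u′} [] (y∈X ∷ _) u-free _ refl =
    contradiction (y , y∈X , prefix-++ y (concat ys) ++ᵖ u′) u-free
  factorisation-unique {xs = x ∷ xs} {u = u} (x∈X ∷ _) [] _ u′-free refl =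
    contradiction (x , x∈X , prefix-++ x (concat xs) ++ᵖ u) u′-free
  factorisation-unique {x ∷ xs} {y ∷ ys} {u} {u′} (x∈X ∷ px) (y∈X ∷ py) u-free u′-free eq
    with common-extension⇒≡ x∈X y∈X
           (prefix-++ x (concat xs) ++ᵖ u)
           (subst (IsPrefixOf y) (sym eq) (prefix-++ y (concat ys) ++ᵖ u′))
  ... | refl with factorisation-unique px py u-free u′-free
                    (++-cancelˡ x _ _ (trans (sym (++-assoc x (concat xs) u))
                                        (trans eq (++-assoc x (concat ys) u′))))
  ...   | eq₁ , eq₂ = cong (x ++_) eq₁ , eq₂

  parse-unique : ∀ {w v x u x′ u′} → IsParse X w (v , x , u) → IsParse X w (v , x′ , u′) →
                 (v , x , u) ≡ (v , x′ , u′)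
  parse-unique {v = v} (refl , _ , (xs , px , refl) , u-free) (eq , _ , (ys , py , refl) , u′-free)
    with factorisation-unique px py u-free u′-free (++-cancelˡ v _ _ eq)
  ... | e₁ , refl = cong (λ x → v , x , _) e₁

  parse-whole : ∀ {w} → w ∈ Star X → IsParse X w ([] , w , [])
  parse-whole {w} w∈X* = sym (++-identityʳ w) , []-no-suffix , w∈X* , []-no-prefix

  star? : ∀ {w n} → ParseCount X w n → Dec (w ∈ Star X)
  star? {w} (l , _ , _ , l⇔) =
    map′ (λ m → proj₁ (proj₂ (proj₂ (Equivalence.to (l⇔ _) m))))
         (λ w∈X* → Equivalence.from (l⇔ _) (parse-whole w∈X*))
         (([] , w , []) ∈? l)
    where open DecMembership (×-≡-dec _≟ʷ_ (×-≡-dec _≟ʷ_ _≟ʷ_)) using (_∈?_)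

  -- The number of factors decides: with two or more, a product lying in `X` would have its first
  -- factor as a proper prefix.
  star⇒code? : ∀ {w} → w ∈ Star X → Dec (w ∈ X)
  star⇒code? ([]         , []          , refl) = no λ []∈X → nonempty-words []∈X refl
  star⇒code? (x ∷ []     , x∈X ∷ []    , refl) = yes (subst X (sym (++-identityʳ x)) x∈X)
  star⇒code? (x ∷ y ∷ zs , x∈X ∷ y∈X ∷ _ , refl) = no λ w∈X →
    nonempty-words y∈X (++-conicalˡ y (concat zs)
      (++-identityʳ-unique x (prefix⇒≡ x∈X w∈X (prefix-++ x _))))

  code? : ∀ {w n} → ParseCount X w n → Dec (w ∈ X)
  code? {w} c with star? c
  ... | yes w∈X* = star⇒code? w∈X*
  ... | no  w∉X* = no λ w∈X → w∉X* (w ∷ [] , w∈X ∷ [] , sym (++-identityʳ w))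

-- Codes that are decidable on a factor-closed set

module DecidableOn {A : Set} (_≟_ : DecidableEquality A)
  {F X : Language {A}} (X-code : IsPrefixCode X)
  (factor-closed : ∀ {u w} → IsFactorOf u w → w ∈ F → u ∈ F)
  (X? : ∀ {w} → w ∈ F → Dec (w ∈ X)) where

  open IsPrefixCode X-code
  open PrefixCodeParses _≟_ X-code

  F-prefix : ∀ {u w} → IsPrefixOf u w → w ∈ F → u ∈ F
  F-prefix u≤w = factor-closed (here u≤w)

  F-suffix : ∀ {u w} → IsSuffixOf u w → w ∈ F → u ∈ F
  F-suffix u≤w = factor-closed (fromSuffix u≤w)

  F-tail : ∀ {a w} → (a ∷ w) ∈ F → w ∈ F
  F-tail = F-suffix (there (here (≡⇒Pointwise-≡ refl)))

  hasSuffix? : ∀ {w} → w ∈ F → Dec (HasSuffixIn X w)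
  hasSuffix? {[]}    _ = no []-no-suffix
  hasSuffix? {a ∷ w} w∈F with X? w∈F
  ... | yes aw∈X = yes (a ∷ w , aw∈X , here (≡⇒Pointwise-≡ refl))
  ... | no  aw∉X = map′ (λ (s , s∈X , s≤w) → s , s∈X , there s≤w) drop (hasSuffix? (F-tail w∈F))
    where
    drop : HasSuffixIn X (a ∷ w) → HasSuffixIn X w
    drop (s , s∈X , here p) = contradiction (subst X (Pointwise-≡⇒≡ p) s∈X) aw∉X
    drop (s , s∈X , there s≤w) = s , s∈X , s≤w

  -- Letters are removed from the right, so every word tested is a prefix of `w` and lies in `F`,
  -- where `X?` applies.
  hasPrefix? : ∀ {w} → w ∈ F → Dec (HasPrefixIn X w)
  hasPrefix? {w} = go (reverseView w)
    where
    go : ∀ {w} → Reverse w → w ∈ F → Dec (HasPrefixIn X w)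
    go [] _ = no []-no-prefix
    go (w ∶ rw ∶ʳ a) wa∈F with X? wa∈F
    ... | yes wa∈X = yes (w ∷ʳ a , wa∈X , prefix-refl)
    ... | no  wa∉X = map′ (λ (p , p∈X , p≤w) → p , p∈X , p≤w ++ᵖ (a ∷ [])) drop
                          (go rw (F-prefix (prefix-++ w _) wa∈F))
      where
      drop : HasPrefixIn X (w ∷ʳ a) → HasPrefixIn X w
      drop (p , p∈X , p≤wa) with prefix-∷ʳ⁻ w p≤wa
      ... | inj₁ p≤w  = p , p∈X , p≤w
      ... | inj₂ refl = contradiction p∈X wa∉X

  -- Codewords are stripped greedily from the left. Since they are nonempty the length drops, which
  -- justifies the well-founded recursion.
  factorise : ∀ {w} → w ∈ F → ∃[ x ] ∃[ u ] w ≡ x ++ u × x ∈ Star X × ¬ HasPrefixIn X u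
  factorise w∈F = go w∈F (<-wellFounded _)
    where
    go : ∀ {w} → w ∈ F → Acc _<_ (length w) →
         ∃[ x ] ∃[ u ] w ≡ x ++ u × x ∈ Star X × ¬ HasPrefixIn X u
    go {w} w∈F (acc rs) with hasPrefix? w∈F
    ... | no  w-free = [] , w , refl , ([] , [] , refl) , w-free
    ... | yes (p , p∈X , p≤w) with prefix⇒++ p≤w
    ...   | t , refl with go (F-suffix (p ++ˢ here (≡⇒Pointwise-≡ refl)) w∈F)
                             (rs (length-<-++ t (nonempty-words p∈X)))
    ...     | _ , u , refl , (xs , pxs , refl) , u-free =
      p ++ concat xs , u , sym (++-assoc p _ u) , (p ∷ xs , p∈X ∷ pxs , refl) , u-free

  -- Projection to the first component is injective on parses by `parse-unique`, and `factorise`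
  -- completes every suffix-free prefix to a parse.
  parseCount≡cardinality : ∀ {w m n} → w ∈ F → ParseCount X w m →
    HasCardinality (SuffixFreePrefix X w) n → m ≡ n
  parseCount≡cardinality {w} w∈F parses prefixes = ≤-antisym
    (cardinality-≤ (λ (v , _) v′ → v ≡ v′)
      (λ { p q refl refl → parse-unique p q })
      (λ { {v , x , u} (refl , v-free , _) → v , (prefix-++ v (x ++ u) , v-free) , refl })
      parses prefixes)
    (cardinality-≤ (λ v (v′ , _) → v ≡ v′) (λ { _ _ refl refl → refl }) parse prefixes parses)
    where
    parse : ∀ {v} → v ∈ SuffixFreePrefix X w → ∃[ t ] t ∈ IsParse X w × v ≡ proj₁ t
    parse {v} (v≤w , v-free) with prefix⇒++ v≤w
    ... | t , refl with factorise (F-suffix (v ++ˢ here (≡⇒Pointwise-≡ refl)) w∈F)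
    ...   | x , u , refl , x∈X* , u-free = (v , x , u) , (refl , v-free , x∈X* , u-free) , refl

  -- Counting suffix-free prefixes

  record PrefixProfile (w : List A) : Set where
    field
      count        : ℕ
      cardinality  : HasCardinality (SuffixFreePrefix X w) count
      -- A discrete intermediate value property: the count starts at 1 for `[]` and rises by one
      -- exactly at the suffix-free prefixes, so each value up to `count` is attained at such a
      -- prefix.
      intermediate : ∀ {i} → 1 ≤ i → i ≤ count →
        ∃[ p ] p ∈ SuffixFreePrefix X w × HasCardinality (SuffixFreePrefix X p) i

  prefixProfile : ∀ {w} → w ∈ F → PrefixProfile w
  prefixProfile {w} = go (reverseView w)
    where
    go : ∀ {w} → Reverse w → w ∈ F → PrefixProfile w
    go [] _ = record
      { count        = 1
      ; cardinality  = cardinality-[]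
      ; intermediate = λ { (s≤s _) (s≤s z≤n) → [] , []-suffixFree [] , cardinality-[] }
      }
    go (w ∶ rw ∶ʳ a) wa∈F with go rw (F-prefix (prefix-++ w _) wa∈F) | hasSuffix? wa∈F
    ... | record { count = n ; cardinality = c ; intermediate = f } | yes wa-suffix = record
      { count        = n
      ; cardinality  = cardinality-cong (extend , restrict) c
      ; intermediate = λ 1≤i i≤n → let p , p∈ , cp = f 1≤i i≤n in p , extend p∈ , cp
      }
      where
      extend : SuffixFreePrefix X w ⊆ SuffixFreePrefix X (w ∷ʳ a)
      extend = suffixFreePrefix-mono (prefix-++ w _)
      restrict : SuffixFreePrefix X (w ∷ʳ a) ⊆ SuffixFreePrefix X w
      restrict (v≤wa , v-free) with prefix-∷ʳ⁻ w v≤wa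
      ... | inj₁ v≤w  = v≤w , v-free
      ... | inj₂ refl = contradiction wa-suffix v-free
    ... | record { count = n ; cardinality = c ; intermediate = f } | no wa-free = record
      { count        = suc n
      ; cardinality  = c′
      ; intermediate = g
      }
      where
      extend : SuffixFreePrefix X w ⊆ SuffixFreePrefix X (w ∷ʳ a)
      extend = suffixFreePrefix-mono (prefix-++ w _)
      split : ∀ {v} → v ∈ SuffixFreePrefix X (w ∷ʳ a) → v ∈ SuffixFreePrefix X w ⊎ v ≡ w ∷ʳ a
      split (v≤wa , v-free) with prefix-∷ʳ⁻ w v≤wa
      ... | inj₁ v≤w = inj₁ (v≤w , v-free)
      ... | inj₂ eq  = inj₂ eq
      c′ : HasCardinality (SuffixFreePrefix X (w ∷ʳ a)) (suc n)
      c′ = cardinality-insert (w ∷ʳ a) (∷ʳ-not-prefix w ∘ proj₁) (prefix-refl , wa-free) extend split c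
      g : ∀ {i} → 1 ≤ i → i ≤ suc n →
        ∃[ p ] p ∈ SuffixFreePrefix X (w ∷ʳ a) × HasCardinality (SuffixFreePrefix X p) i
      g 1≤i i≤1+n with m≤n⇒m<n∨m≡n i≤1+n
      ... | inj₁ i<1+n = let p , p∈ , cp = f 1≤i (≤-pred i<1+n) in p , extend p∈ , cp
      -- The new value `suc n` is attained by the whole word, which is suffix-free in this branch.
      ... | inj₂ refl  = w ∷ʳ a , (prefix-refl , wa-free) , c′

  -- Prepending a to a suffix-free prefix v of w spoils it only if a ∷ v ∈ X,
  -- which happens for at most one v; that v is sent to [].
  cardinality-∷ : ∀ {a w m n} → (a ∷ w) ∈ F → HasCardinality (SuffixFreePrefix X w) m →
    HasCardinality (SuffixFreePrefix X (a ∷ w)) n → m ≤ n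
  cardinality-∷ {a} {w} aw∈F = cardinality-≤ R R-injective R-total
    where
    R : List A → List A → Set
    R v v′ = ((a ∷ v) ∈ X × v′ ≡ []) ⊎ v′ ≡ a ∷ v
    R-injective : ∀ {v₁ v₂ v′} → v₁ ∈ SuffixFreePrefix X w → v₂ ∈ SuffixFreePrefix X w →
                  R v₁ v′ → R v₂ v′ → v₁ ≡ v₂
    R-injective (v₁≤w , _) (v₂≤w , _) (inj₁ (av₁∈X , refl)) (inj₁ (av₂∈X , _))
      with refl ← common-extension⇒≡ av₁∈X av₂∈X (refl ∷ v₁≤w) (refl ∷ v₂≤w) = refl
    -- The mixed cases are impossible, since `[]` is not of the form `a ∷ v`.
    R-injective _ _ (inj₂ refl) (inj₂ refl) = refl
    R-total : ∀ {v} → v ∈ SuffixFreePrefix X w → ∃[ v′ ] v′ ∈ SuffixFreePrefix X (a ∷ w) × R v v′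
    R-total {v} (v≤w , v-free) with X? (F-prefix (refl ∷ v≤w) aw∈F)
    ... | yes av∈X = [] , []-suffixFree _ , inj₁ (av∈X , refl)
    ... | no  av∉X = a ∷ v , (refl ∷ v≤w , λ
      { (_ , s∈X , here e)    → av∉X (subst X (Pointwise-≡⇒≡ e) s∈X)
      ; (s , s∈X , there s≤v) → v-free (s , s∈X , s≤v) }) , inj₂ refl

  cardinality-++ʳ : ∀ t {w m n} → (t ++ w) ∈ F → HasCardinality (SuffixFreePrefix X w) m →
    HasCardinality (SuffixFreePrefix X (t ++ w)) n → m ≤ n
  cardinality-++ʳ []      _     c c′ = ≤-reflexive (cardinality-unique c c′)
  cardinality-++ʳ (a ∷ t) atw∈F c c′ =
    let open PrefixProfile (prefixProfile (F-tail atw∈F))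
    in ≤-trans (cardinality-++ʳ t (F-tail atw∈F) c cardinality) (cardinality-∷ atw∈F cardinality c′)

-- Bifix codes of finite degree

module FiniteDegree {A : Set} (_≟_ : DecidableEquality A)
  {F X : Language {A}} (F-recurrent : IsRecurrent F) (X⊆F : X ⊆ F) (X-bifix : IsBifixCode X)
  {d : ℕ} (X-degree : HasDegree F X d) where

  open IsRecurrent F-recurrent
  open IsBifixCode X-bifix
  open HasDegree X-degree
  open PrefixCodeParses _≟_ isPrefixCode
  open DecidableOn _≟_ isPrefixCode factor-closed (λ w∈F → code? (proj₁ (proj₂ (bounded w∈F))))
  open PrefixProfile

  cardinality≤degree : ∀ {w n} → w ∈ F → HasCardinality (SuffixFreePrefix X w) n → n ≤ d
  cardinality≤degree w∈F c with bounded w∈F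
  ... | m , parses , m≤d = subst (_≤ d) (parseCount≡cardinality w∈F parses c) m≤d

  attained-cardinality : ∃[ w ] w ∈ F × HasCardinality (SuffixFreePrefix X w) d
  attained-cardinality with attained
  ... | w , w∈F , parses = w , w∈F ,
    subst (HasCardinality _) (sym (parseCount≡cardinality w∈F parses c)) c
    where c = cardinality (prefixProfile w∈F)

  suffixFree⇒properSuffix : ∀ {p} → p ∈ F → p ≢ [] → ¬ HasSuffixIn X p → p ∈ NonemptyProperSuffixes X
  suffixFree⇒properSuffix {p} p∈F p≢[] p-free with attained-cardinality
  ... | u , u∈F , cu with recurrent u∈F p∈F
  ...   | v , _ , uvp∈F with hasSuffix? uvp∈F
  -- Otherwise the whole word would be a suffix-free prefix beyond the `d` already present in `u`,
  -- pushing the count above the degree.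
  ...     | no uvp-free = contradiction (cardinality≤degree uvp∈F c) (<⇒≱ (cardinality-<
              (u ++ v ++ p) uvp∉ (prefix-refl , uvp-free) (suffixFreePrefix-mono (prefix-++ u _)) cu c))
    where
    c = cardinality (prefixProfile uvp∈F)
    uvp∉ : ¬ (u ++ v ++ p) ∈ SuffixFreePrefix X u
    uvp∉ (uvp≤u , _) = p≢[] (++-conicalʳ v p
      (++-identityʳ-unique u (prefix-antisym (prefix-++ u _) uvp≤u)))
  -- The codeword `x` and `p` are suffixes of the same word, hence comparable; `x` cannot be a
  -- suffix of `p`, so `p` is one of `x`.
  ...     | yes (x , x∈X , x≤uvp) with suffix-total x≤uvp (u ++ˢ v ++ˢ here (≡⇒Pointwise-≡ refl))
  ...       | inj₁ x≤p = contradiction (x , x∈X , x≤p) p-free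
  ...       | inj₂ p≤x = p≢[] , x , x∈X , p≤x ,
    λ { refl → p-free (p , x∈X , here (≡⇒Pointwise-≡ refl)) }

  -- This is where the suffix half of bifixity enters: a codeword `y` ending `s` would be a proper
  -- suffix of `x`, for `y` equal to `x` would squeeze `s` into equality with `x`.
  properSuffix⇒suffixFree : ∀ {s} → s ∈ NonemptyProperSuffixes X → ¬ HasSuffixIn X s
  properSuffix⇒suffixFree (_ , x , x∈X , s≤x , s≢x) (y , y∈X , y≤s) =
    no-proper-suffix y∈X x∈X (Suffix.trans trans y≤s s≤x ,
      λ { refl → s≢x (Pointwise-≡⇒≡ (Suffix.antisym (λ e _ → e) s≤x y≤s)) })

  properSuffixes⊆F : NonemptyProperSuffixes X ⊆ F
  properSuffixes⊆F (_ , x , x∈X , s≤x , _) = F-suffix s≤x (X⊆F x∈X)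

  -- Layers of proper suffixes by number of parses

  Layer : ℕ → Language {A}
  Layer i s = s ∈ NonemptyProperSuffixes X × HasCardinality (SuffixFreePrefix X s) i

  -- If `s` is a proper prefix of `t`, then `t` itself is a suffix-free prefix of `t` not counted
  -- for `s`, so the two counts differ.
  layer-prefixCode : ∀ i → IsPrefixCode (Layer i)
  layer-prefixCode i = record
    { nonempty-words   = λ (s∈S , _) → proj₁ s∈S
    ; no-proper-prefix = λ { (s∈S , cs) (t∈S , ct) (s≤t , s≢t) →
        n≮n i (cardinality-< _ (λ (t≤s , _) → s≢t (prefix-antisym s≤t t≤s))
          (prefix-refl , properSuffix⇒suffixFree t∈S) (suffixFreePrefix-mono s≤t) cs ct) }
    }

  layer-comparable : ∀ {i z} → 2 ≤ i → i ≤ d → z ∈ F →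
    ∃[ p ] p ∈ Layer i × (IsPrefixOf z p ⊎ IsPrefixOf p z)
  layer-comparable {i} {z} 2≤i i≤d z∈F with attained-cardinality
  ... | u , u∈F , cu with recurrent z∈F u∈F
  ...   | v , _ , zvu∈F =
    let profile = prefixProfile zvu∈F
        assoc   = sym (++-assoc z v u)
        -- The final factor `u` already has count `d`, and prepending `z ++ v` does not lower it.
        d≤count = cardinality-++ʳ (z ++ v) (subst F assoc zvu∈F) cu
          (subst (λ w → HasCardinality (SuffixFreePrefix X w) (count profile)) assoc (cardinality profile))
        p , (p≤ , p-free) , cp =
          intermediate profile (≤-trans (s≤s z≤n) 2≤i) (≤-trans i≤d d≤count)
    -- The bound `2 ≤ i` makes `p` nonempty, because `[]` has count 1.
    in p , (suffixFree⇒properSuffix (F-prefix p≤ zvu∈F) (cardinality≥2⇒nonempty 2≤i cp) p-free , cp) ,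
       prefix-total (prefix-++ z _) p≤

  layer-maximal : ∀ {i} → 2 ≤ i → i ≤ d → IsMaximalPrefixCode F (Layer i)
  layer-maximal {i} 2≤i i≤d = record
    { isPrefixCode = layer-prefixCode i
    ; contained    = properSuffixes⊆F ∘ proj₁
    ; maximal      = max
    }
    where
    max : (Z : Language) → IsPrefixCode Z → Z ⊆ F → Layer i ⊆ Z → Z ⊆ Layer i
    -- Both `z` and the comparable layer element `p` lie in the prefix code `Z`, so they coincide.
    max Z Z-code Z⊆F Y⊆Z z∈Z with layer-comparable 2≤i i≤d (Z⊆F z∈Z)
    ... | p , p∈Y , inj₁ z≤p = subst (Layer i) (sym (Z.prefix⇒≡ z∈Z (Y⊆Z p∈Y) z≤p)) p∈Y
      where module Z = PrefixCodeParses _≟_ Z-code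
    ... | p , p∈Y , inj₂ p≤z = subst (Layer i) (Z.prefix⇒≡ (Y⊆Z p∈Y) z∈Z p≤z) p∈Y
      where module Z = PrefixCodeParses _≟_ Z-code

  -- The lower bound comes from two distinct suffix-free prefixes of `s`, namely `[]` and `s`; the
  -- upper bound is the degree.
  properSuffix-layer : ∀ {s} → s ∈ NonemptyProperSuffixes X → ∃[ i ] 2 ≤ i × i ≤ d × s ∈ Layer i
  properSuffix-layer {s} s∈S@(s≢[] , _) =
    _ , length≤cardinality c (((s≢[] ∘ sym) ∷ []) ∷ [] ∷ [])
          (λ { (here refl) → []-suffixFree s
             ; (there (here refl)) → prefix-refl , properSuffix⇒suffixFree s∈S }) ,
    cardinality≤degree s∈F c , s∈S , c
    where
    s∈F = properSuffixes⊆F s∈S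
    c   = cardinality (prefixProfile s∈F)

  properSuffixes-decomposition :
    IsDisjointUnionOfMaximalPrefixCodes F (NonemptyProperSuffixes X) (d ∸ 1)
  properSuffixes-decomposition = record
    -- Counts of nonempty proper suffixes range from 2 to `d`, hence the shift by 2 and the `d ∸ 1`
    -- parts.
    { part     = λ i → Layer (2 + toℕ i)
    ; maximal  = λ i → layer-maximal (s≤s (s≤s z≤n)) (index≤d i)
    ; disjoint = λ { i≢j ((_ , c) , (_ , c′)) →
        i≢j (Fin.toℕ-injective (suc-injective (suc-injective (cardinality-unique c c′)))) }
    ; union    = toPart , λ (_ , s∈S , _) → s∈S
    }
    where
    index≤d : (i : Fin (d ∸ 1)) → 2 + toℕ i ≤ d
    index≤d i = m<n∸1⇒1+m<n (Fin.toℕ<n i)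
      where
      m<n∸1⇒1+m<n : ∀ {m n} → m < n ∸ 1 → suc m < n
      -- For `n = 0` truncated subtraction gives `0 ∸ 1 = 0`, so the hypothesis is absurd.
      m<n∸1⇒1+m<n {n = suc n} m<n = s≤s m<n
    toPart : ∀ {s} → s ∈ NonemptyProperSuffixes X → ∃[ i ] s ∈ Layer (2 + toℕ i)
    toPart s∈S with properSuffix-layer s∈S
    ... | suc (suc i) , s≤s (s≤s _) , i+2≤d , _ , c =
      fromℕ< i<d∸1 , s∈S , subst (λ j → HasCardinality _ (2 + j)) (sym (Fin.toℕ-fromℕ< i<d∸1)) c
      where i<d∸1 = ∸-monoˡ-≤ 1 i+2≤d

mainTheorem5 : (A : Set) (k : ℕ) → A ↔ Fin k →
    (F X : Language {A}) → IsRecurrent F → X ⊆ F → IsBifixCode X →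
    (d : ℕ) → HasDegree F X d →
    IsDisjointUnionOfMaximalPrefixCodes F (NonemptyProperSuffixes X) (d ∸ 1)
mainTheorem5 A k A↔Fin F X F-recurrent X⊆F X-bifix d X-degree =
  -- Finiteness of the alphabet supplies decidable equality of letters, pulled back from `Fin k`.
  FiniteDegree.properSuffixes-decomposition (via-injection (↔⇒↣ A↔Fin) Fin._≟_)
    F-recurrent X⊆F X-bifix X-degree
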